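{- For $n\ge 3$, let $W_n$ be the wheel graph of order $n+1$. Then $sn(W_n)=2$ if $n$ is even, $sn(W_3)=3$, and $sn(W_n)=\frac{n+1}{2}$ if $n\ge 5$ is odd.
   Context: Graphs are finite, undirected and simple. The wheel graph $W_n$, $n\ge 3$, of order $n+1$ is obtained from an $n$-cycle $C_n=v_1v_2\cdots v_nv_1$ by joining a new vertex $u$ to every vertex of $C_n$. Let $G=(V,E)$ be a connected graph with chromatic number $\chi(G)=k\ge 2$. For $S\subset V$, a partial coloring on $G[S]$ is a proper coloring $\mathscr C_0$ of the induced subgraph $G[S]$ with colors from $\{1,\dots,k\}$ (not all colors need be used). It is a Sudoku coloring of $G$ if there is exactly one proper $k$-coloring $V\to\{1,\dots,k\}$ of $G$ whose restriction to $S$ is $\mathscr C_0$. The Sudoku number $sn(G)$ is the smallest $|S|$ such that $G[S]$ admits a Sudoku coloring of $G$. -}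

module Defs where

open import Data.Empty using (⊥)
open import Data.Fin using (Fin; zero; suc; toℕ)
open import Data.Fin.Subset using (Subset; _∈_; ∣_∣)
open import Data.Nat using (ℕ; suc; _≤_; s≤s)
open import Data.Nat.Properties using (1+n≢n)
open import Data.Product using (∃; ∃!; _×_; _,_; proj₁)
open import Data.Sum using (_⊎_; inj₁; inj₂; swap)
open import Data.Unit using (⊤)
open import Relation.Binary using (Symmetric; Irreflexive; Rel)
open import Relation.Binary.Construct.Closure.ReflexiveTransitive using (Star)
open import Relation.Binary.PropositionalEquality
  using (_≡_; _≢_; refl; sym; trans; cong; _≗_)
open import Relation.Nullary using (¬_)
open import Level using (0ℓ)

record SimpleGraph (V : Set) : Set₁ where
  field
    Adj    : Rel V 0ℓ
    symm   : Symmetric Adj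
    irrefl : Irreflexive _≡_ Adj

open SimpleGraph public

-- A finite graph on m vertices is a SimpleGraph (Fin m); induced subgraphs
-- have the subtype ∃ (_∈ S) as vertex set.

induced : {m : ℕ} → SimpleGraph (Fin m) → (S : Subset m) →
          SimpleGraph (∃ λ v → v ∈ S)
induced G S = record
  { Adj    = λ x y → Adj G (proj₁ x) (proj₁ y)
  ; symm   = symm G
  ; irrefl = λ x≡y → irrefl G (cong proj₁ x≡y)
  }

Connected : {V : Set} → SimpleGraph V → Set
Connected {V} G = (x y : V) → Star (Adj G) x y

Proper : {V : Set} → SimpleGraph V → {k : ℕ} → (V → Fin k) → Set
Proper {V} G c = (x y : V) → Adj G x y → c x ≢ c y

Colorable : {V : Set} → SimpleGraph V → ℕ → Set
Colorable {V} G k = ∃ λ (c : V → Fin k) → Proper G c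

IsLeast : (ℕ → Set) → ℕ → Set
IsLeast P m = P m × ((j : ℕ) → P j → m ≤ j)

IsChromaticNumber : {V : Set} → SimpleGraph V → ℕ → Set
IsChromaticNumber G k = IsLeast (Colorable G) k

RestrictsTo : {m k : ℕ} {S : Subset m} →
              (Fin m → Fin k) → ((∃ λ v → v ∈ S) → Fin k) → Set
RestrictsTo {S = S} c c₀ = (x : ∃ λ v → v ∈ S) → c (proj₁ x) ≡ c₀ x

IsSudokuColoring : {m : ℕ} → SimpleGraph (Fin m) → (k : ℕ) →
                   (S : Subset m) → ((∃ λ v → v ∈ S) → Fin k) → Set
IsSudokuColoring G k S c₀ =
  Proper (induced G S) c₀ ×
  ∃! _≗_ (λ c → Proper G c × RestrictsTo {S = S} c c₀)

-- Some vertex set of size s carries a partial k-coloring that is Sudoku.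
HasSudokuSet : {m : ℕ} → SimpleGraph (Fin m) → (k s : ℕ) → Set
HasSudokuSet {m} G k s =
  ∃ λ (S : Subset m) → ∣ S ∣ ≡ s ×
  ∃ λ (c₀ : (∃ λ v → v ∈ S) → Fin k) → IsSudokuColoring G k S c₀

-- "sn(G) = s" as a relation. The Sudoku number is only defined for connected
-- graphs with χ(G) ≥ 2, so these conditions are part of the assertion; the
-- number of colors is pinned down as the chromatic number.
record IsSudokuNumber {m : ℕ} (G : SimpleGraph (Fin m)) (s : ℕ) : Set where
  field
    connected   : Connected G
    k           : ℕ
    isChromatic : IsChromaticNumber G k
    2≤k         : 2 ≤ k
    isLeast     : IsLeast (HasSudokuSet G k) s

-- The vertices of the n-cycle in cyclic order are 0, 1, …, n − 1.
Next : {n : ℕ} → Rel (Fin n) 0ℓ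
Next {n} i j = (toℕ j ≡ suc (toℕ i)) ⊎ (suc (toℕ i) ≡ n × toℕ j ≡ 0)

¬Next-self : {n : ℕ} → 3 ≤ n → (i : Fin n) → ¬ Next i i
¬Next-self 3≤n i (inj₁ e) = 1+n≢n (sym e)
¬Next-self 3≤n i (inj₂ (e , z)) with trans (sym e) (cong suc z)
¬Next-self (s≤s ()) i (inj₂ (e , z)) | refl

cycle : (n : ℕ) → 3 ≤ n → SimpleGraph (Fin n)
cycle n 3≤n = record
  { Adj    = λ i j → Next i j ⊎ Next j i
  ; symm   = swap
  ; irrefl = λ { {i} refl (inj₁ e) → ¬Next-self 3≤n i e
               ; {i} refl (inj₂ e) → ¬Next-self 3≤n i e }
  }

-- Join with a new vertex, numbered zero; the old vertex i becomes suc i.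
cone : {n : ℕ} → SimpleGraph (Fin n) → SimpleGraph (Fin (suc n))
cone {n} G = record
  { Adj = adj
  ; symm = λ {x} {y} → adj-sym x y
  ; irrefl = λ { {x} refl → adj-irrefl x }
  }
  where
  adj : Rel (Fin (suc n)) 0ℓ
  adj zero    zero    = ⊥
  adj zero    (suc _) = ⊤
  adj (suc _) zero    = ⊤
  adj (suc i) (suc j) = Adj G i j

  adj-sym : ∀ x y → adj x y → adj y x
  adj-sym zero    (suc _) e = e
  adj-sym (suc _) zero    e = e
  adj-sym (suc _) (suc _) e = symm G e

  adj-irrefl : ∀ x → ¬ adj x x
  adj-irrefl (suc _) e = irrefl G refl e

wheel : (n : ℕ) → 3 ≤ n → SimpleGraph (Fin (suc n))
wheel n 3≤n = cone (cycle n 3≤n)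

{-# OPTIONS --safe #-}

-- Lower bounds. Two colours missing on S can be swapped, so a set carrying a
-- Sudoku colouring has at least χ − 1 vertices. If n is odd, then χ = 4, and
-- S covers every rim edge xy: among the three colours other than that of the
-- hub, x or y can be recoloured alone unless both outer neighbours have the
-- third colour, in which case x and y can be swapped. A vertex cover of an
-- odd n-cycle has at least (n + 1) / 2 vertices.
-- Upper bounds. For even n take the hub and one rim vertex. For odd n take the
-- rim vertices 0, 2, …, n − 1 with a proper colouring of the cycle they form;
-- if it uses three colours, the hub is forced, and then each remaining vertex
-- is forced as its three neighbours have distinct colours.
module Submission where

open import Defs
open import Data.Bool using (Bool; true; false)
open import Data.Empty using (⊥; ⊥-elim)
open import Data.Fin using (Fin; zero; suc; toℕ; fromℕ; fromℕ<; inject₁; inject≤; punchIn; punchOut)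
open import Data.Fin.Permutation.Components using (transpose; transpose-inverse)
open import Data.Fin.Properties
  using (_≟_; any?; all?; toℕ-injective; toℕ<n; toℕ-inject₁; toℕ-fromℕ; toℕ-fromℕ<;
         inject≤-injective; punchIn-injective; punchInᵢ≢i; punchOut-injective; 0≢1+n)
  renaming (suc-injective to sucF-injective)
open import Data.Fin.Subset using (Subset; inside; outside; _∈_; ∣_∣; ⁅_⁆)
open import Data.Fin.Subset.Properties using (∣p∣≤∣x∷p∣; _∈?_; drop-there; x∈⁅x⁆; ∣⁅x⁆∣≡1)
open import Data.Nat using (ℕ; zero; suc; _≤_; _<_; _+_; _*_; z≤n; s≤s; _≤?_)
open import Data.Nat.DivMod using (_/_; m*n/n≡m)
open import Data.Nat.Divisibility using (_∣_; divides)
open import Data.Nat.Properties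
  using (≤-trans; ≤-refl; ≤-reflexive; ≮⇒≥; ≰⇒>; ≤-antisym; <⇒≢; 1+n≰n; 1+n≢0; ≤-pred; _<?_; +-comm;
         m≤m+n; m≤n+m; *-cancelʳ-<; *-monoˡ-≤; suc-injective)
open import Data.Product using (∃; _×_; _,_; proj₁; proj₂)
open import Data.Sum using (_⊎_; inj₁; inj₂) renaming (map to ⊎-map)
open import Data.Unit using (tt)
open import Data.Vec using ([]; _∷_; here; there; lookup)
open import Data.Vec.Properties using ([]=⇒lookup)
open import Function using (_∘_; Injective)
open import Relation.Binary.Construct.Closure.ReflexiveTransitive using (ε; _◅_)
open import Relation.Binary.PropositionalEquality
  using (_≡_; _≢_; refl; sym; trans; cong; subst; _≗_)
open import Relation.Nullary using (¬_; yes; no; contradiction)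
open import Relation.Nullary.Decidable using (from-yes; ¬?; _×-dec_; _→-dec_; dec-true; dec-false)

-- Sudoku colourings as restrictions of total colourings

-- A total colouring `c` stands in for the partial one through its values on `S`; the two lemmas
-- below pass between the two views.
UniqueOn : {m k : ℕ} → SimpleGraph (Fin m) → Subset m → (Fin m → Fin k) → Set
UniqueOn {m} {k} G S c =
  (c′ : Fin m → Fin k) → Proper G c′ → (∀ v → v ∈ S → c′ v ≡ c v) → c ≗ c′

module _ {m k : ℕ} {G : SimpleGraph (Fin m)} {S : Subset m} where

  sudoku-restriction : {c : Fin m → Fin k} → Proper G c → UniqueOn G S c →
                       IsSudokuColoring G k S (c ∘ proj₁)
  sudoku-restriction {c} proper unique =
    (λ x y → proper (proj₁ x) (proj₁ y)) , c , (proper , λ _ → refl) ,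
    λ { {c′} (proper′ , agree) → unique c′ proper′ (λ v v∈S → agree (v , v∈S)) }

  sudoku-completion : {c₀ : ∃ (_∈ S) → Fin k} → IsSudokuColoring G k S c₀ →
                      ∃ λ (c : Fin m → Fin k) → Proper G c × UniqueOn G S c
  sudoku-completion (_ , c , (proper , restr) , unique) =
    c , proper , λ c′ proper′ agree →
      unique (proper′ , λ x → trans (agree (proj₁ x) (proj₂ x)) (restr x))

-- The bound χ - 1 from missing colours

transpose-injective : ∀ {n} (i j : Fin n) → Injective _≡_ _≡_ (transpose i j)
transpose-injective i j {x} {y} e =
  trans (sym (transpose-inverse j i)) (trans (cong (transpose j i) e) (transpose-inverse j i))

transpose-matchˡ : ∀ {n} (i j : Fin n) → transpose i j i ≡ j
transpose-matchˡ i j rewrite dec-true (i ≟ i) refl = refl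

transpose-other : ∀ {n} {i j k : Fin n} → k ≢ i → k ≢ j → transpose i j k ≡ k
transpose-other {i = i} {j} {k} k≢i k≢j
  rewrite dec-false (k ≟ i) k≢i | dec-false (k ≟ j) k≢j = refl

¬colorable⇒< : {V : Set} {G : SimpleGraph V} {k j : ℕ} → ¬ Colorable G k → Colorable G j → k < j
¬colorable⇒< {k = k} {j} ¬col (c , proper) with k <? j
... | yes k<j = k<j
... | no k≮j  = ⊥-elim (¬col ((λ v → inject≤ (c v) (≮⇒≥ k≮j)) ,
                  λ x y xy e → proper x y xy (inject≤-injective _ _ _ _ e)))

-- A colour that does not occur could be punched out of the palette, leaving a proper colouring with
-- one colour fewer.
chromatic-used : {m k : ℕ} {G : SimpleGraph (Fin m)} → IsChromaticNumber G k →
                 {c : Fin m → Fin k} → Proper G c → (a : Fin k) → ∃ λ v → c v ≡ a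
chromatic-used {k = suc k} (_ , least) {c} proper a with any? (λ v → c v ≟ a)
... | yes used   = used
... | no  unused = ⊥-elim (1+n≰n (least k
  ( (λ v → punchOut (a≢c v))
  , λ x y xy e → proper x y xy (punchOut-injective (a≢c x) (a≢c y) e))))
  where
  a≢c : ∀ v → a ≢ c v
  a≢c v e = unused (v , sym e)

-- Each vertex of `S` rules out at most one index of the injective list `f`, so `j` of the
-- `∣ S ∣ + j` indices survive; `e` enumerates them.
missed-colors : {m k j : ℕ} (S : Subset m) (c : Fin m → Fin k)
                (f : Fin (∣ S ∣ + j) → Fin k) → Injective _≡_ _≡_ f →
                ∃ λ (e : Fin j → Fin (∣ S ∣ + j)) →
                  Injective _≡_ _≡_ e × (∀ v → v ∈ S → ∀ i → f (e i) ≢ c v)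
missed-colors [] c f inj = (λ i → i) , (λ eq → eq) , λ ()
missed-colors (outside ∷ S) c f inj with missed-colors S (c ∘ suc) f inj
... | e , e-inj , avoid = e , e-inj , λ { (suc v) (there v∈S) → avoid v v∈S }
missed-colors {k = k} (inside ∷ S) c f inj =
  let i , f≢c₀ = drop
      e , e-inj , avoid = missed-colors S (c ∘ suc) (f ∘ punchIn i) (punchIn-injective i _ _ ∘ inj)
  in punchIn i ∘ e , (e-inj ∘ punchIn-injective i _ _) ,
     λ { zero here j → f≢c₀ (e j) ; (suc v) (there v∈S) j → avoid v v∈S j }
  where
  drop : ∃ λ i → ∀ j → f (punchIn i j) ≢ c zero
  drop with any? (λ i → f i ≟ c zero)
  ... | yes (i , fi≡c₀) = i , λ j e → punchInᵢ≢i i j (inj (trans e (sym fi≡c₀)))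
  -- The colour of this vertex is not in the list; some index must still be dropped to keep the
  -- count, and `zero` is an arbitrary choice.
  ... | no ∄            = zero , λ j e → ∄ (suc j , e)

chromatic≤1+sudoku : {m k s : ℕ} {G : SimpleGraph (Fin m)} →
                     IsChromaticNumber G k → HasSudokuSet G k s → k ≤ suc s
chromatic≤1+sudoku {k = k} {G = G} χ (S , refl , _ , sudoku) with k ≤? suc ∣ S ∣
... | yes k≤ = k≤
... | no  k≰ = ⊥-elim
        let c , proper , unique = sudoku-completion {G = G} sudoku
            S+2≤k = ≤-trans (≤-reflexive (+-comm ∣ S ∣ 2)) (≰⇒> k≰)
            f = λ i → inject≤ i S+2≤k
            f-inj : Injective _≡_ _≡_ f
            f-inj = inject≤-injective S+2≤k S+2≤k _ _
            e , e-inj , avoid = missed-colors S c f f-inj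
            a = f (e zero)
            b = f (e (suc zero))
            a≢b : a ≢ b
            a≢b eq = 0≢1+n (e-inj (f-inj eq))
            -- The swap fixes all colours on `S` but moves this vertex, against uniqueness.
            v , cv≡a = chromatic-used {G = G} χ proper a
            fixed = unique (transpose a b ∘ c)
                      (λ x y xy → proper x y xy ∘ transpose-injective a b)
                      (λ w w∈S → transpose-other (avoid w w∈S zero ∘ sym)
                                                 (avoid w w∈S (suc zero) ∘ sym))
        in a≢b (trans (sym cv≡a) (trans (fixed v)
                 (trans (cong (transpose a b) cv≡a) (transpose-matchˡ a b))))

-- Wheels: connectedness, colourings, edges

module _ {n : ℕ} (3≤n : 3 ≤ n) where

  private
    W : SimpleGraph (Fin (suc n))
    W = wheel n 3≤n

  wheel-connected : Connected W
  wheel-connected zero    zero    = ε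
  wheel-connected zero    (suc j) = tt ◅ ε
  wheel-connected (suc i) zero    = tt ◅ ε
  wheel-connected (suc i) (suc j) = _◅_ {j = zero} tt (tt ◅ ε)

  -- The rim pattern is a function on ℕ, so that periodic patterns can be defined by recursion
  -- independently of `n`.
  wheelColoring : ∀ {k} → (ℕ → Fin k) → Fin (suc n) → Fin (suc k)
  wheelColoring f zero    = zero
  wheelColoring f (suc i) = suc (f (toℕ i))

  wheelColoring-proper : ∀ {k} (f : ℕ → Fin k) → (∀ i → f i ≢ f (suc i)) →
                         (∀ i → suc i ≡ n → f i ≢ f 0) → Proper W (wheelColoring f)
  wheelColoring-proper f step wrap = proper
    where
    next : ∀ {i j : Fin n} → Next i j → f (toℕ i) ≢ f (toℕ j)
    next {i} (inj₁ e)       eq = step (toℕ i) (trans eq (cong f e))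
    next {i} (inj₂ (e , z)) eq = wrap (toℕ i) e (trans eq (cong f z))

    proper : Proper W (wheelColoring f)
    proper zero    (suc j) _         ()
    proper (suc i) zero    _         ()
    proper (suc i) (suc j) (inj₁ ij) e = next ij (sucF-injective e)
    proper (suc i) (suc j) (inj₂ ji) e = next ji (sym (sucF-injective e))

  rim-edge : ∀ {k} {c : Fin (suc n) → Fin k} → Proper W c →
             {i j : Fin n} → toℕ j ≡ suc (toℕ i) → c (suc i) ≢ c (suc j)
  rim-edge proper {i} {j} e = proper (suc i) (suc j) (inj₁ (inj₁ e))

  spoke : ∀ {k} {c : Fin (suc n) → Fin k} → Proper W c → ∀ i → c (suc i) ≢ c zero
  spoke proper i = proper (suc i) zero tt

Fin-pred : ∀ {n k} (i : Fin n) → toℕ i ≡ suc k → ∃ λ (j : Fin n) → toℕ j ≡ k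
Fin-pred (suc i) e = inject₁ i , trans (toℕ-inject₁ i) (suc-injective e)

-- Small palettes, checked exhaustively

-- With three colours, a vertex having two differently coloured neighbours is forced.
third-unique : ∀ (a b x y : Fin 3) → a ≢ b →
               x ≢ a → x ≢ b → y ≢ a → y ≢ b → x ≡ y
third-unique = from-yes (all? {3} λ a → all? λ b → all? λ x → all? λ y →
  ¬? (a ≟ b) →-dec (¬? (x ≟ a) →-dec (¬? (x ≟ b) →-dec (¬? (y ≟ a) →-dec
  (¬? (y ≟ b) →-dec (x ≟ y))))))

-- The analogue for four colours: three neighbours of distinct colours force a vertex.
fourth-unique : ∀ (a b c x y : Fin 4) → a ≢ b → a ≢ c → b ≢ c →
                x ≢ a → x ≢ b → x ≢ c → y ≢ a → y ≢ b → y ≢ c → x ≡ y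
fourth-unique = from-yes (all? {4} λ a → all? λ b → all? λ c → all? λ x → all? λ y →
  ¬? (a ≟ b) →-dec (¬? (a ≟ c) →-dec (¬? (b ≟ c) →-dec
  (¬? (x ≟ a) →-dec (¬? (x ≟ b) →-dec (¬? (x ≟ c) →-dec
  (¬? (y ≟ a) →-dec (¬? (y ≟ b) →-dec (¬? (y ≟ c) →-dec (x ≟ y))))))))))

fourth-color : ∀ (a b c : Fin 4) → ∃ λ t → t ≢ a × t ≢ b × t ≢ c
fourth-color = from-yes (all? {4} λ a → all? λ b → all? λ c → any? λ t →
  ¬? (t ≟ a) ×-dec (¬? (t ≟ b) ×-dec ¬? (t ≟ c)))

no-2-colored-triangle : ∀ (a b c : Fin 2) → a ≢ b → a ≢ c → ¬ (b ≢ c)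
no-2-colored-triangle = from-yes (all? {2} λ a → all? λ b → all? λ c →
  ¬? (a ≟ b) →-dec (¬? (a ≟ c) →-dec ¬? (¬? (b ≟ c))))

-- Even wheels

alternating : ℕ → Fin 2
alternating zero          = zero
alternating (suc zero)    = suc zero
alternating (suc (suc i)) = alternating i

alternating-step : ∀ i → alternating i ≢ alternating (suc i)
alternating-step zero          ()
alternating-step (suc zero)    ()
alternating-step (suc (suc i)) = alternating-step i

alternating-even : ∀ m → alternating (m * 2) ≡ zero
alternating-even zero    = refl
alternating-even (suc m) = alternating-even m

module EvenWheel (m : ℕ) (3≤n : 3 ≤ suc m * 2) where

  W : SimpleGraph (Fin (suc (suc m * 2)))
  W = wheel (suc m * 2) 3≤n

  coloring : Fin (suc (suc m * 2)) → Fin 3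
  coloring = wheelColoring 3≤n alternating

  coloring-proper : Proper W coloring
  coloring-proper = wheelColoring-proper 3≤n alternating alternating-step wrap
    where
    wrap : ∀ i → suc i ≡ suc m * 2 → alternating i ≢ alternating 0
    -- The last rim index is `suc (m * 2)`; its colour differs from that of `m * 2`, which is the
    -- colour of index 0.
    wrap i e eq rewrite suc-injective e =
      alternating-step (m * 2) (trans (alternating-even m) (sym eq))

  chromatic : IsChromaticNumber W 3
  chromatic = (coloring , coloring-proper) , λ _ → ¬colorable⇒< {G = W} ¬2-colorable
    where
    ¬2-colorable : ¬ Colorable W 2
    ¬2-colorable (c , proper) = no-2-colored-triangle (c zero) (c (suc zero)) (c (suc (suc zero)))
      (proper _ _ tt) (proper _ _ tt) (rim-edge 3≤n proper refl)

  S : Subset (suc (suc m * 2))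
  S = inside ∷ ⁅ zero ⁆

  coloring-unique : UniqueOn W S coloring
  coloring-unique c proper agree = λ
    { zero → sym hub ; (suc i) → sym (rim (toℕ i) i refl) }
    where
    hub : c zero ≡ zero
    hub = agree zero here

    -- Walking along the rim, the hub and the preceding rim vertex leave only one colour.
    rim : ∀ k i → toℕ i ≡ k → c (suc i) ≡ suc (alternating k)
    rim zero    zero _ = agree (suc zero) (there (x∈⁅x⁆ {suc m * 2} zero))
    rim (suc k) i    e with Fin-pred i e
    ... | j , e′ = third-unique (c zero) (c (suc j)) _ _
      (spoke 3≤n proper j ∘ sym)
      (spoke 3≤n proper i)
      (rim-edge 3≤n proper (trans e (cong suc (sym e′))) ∘ sym)
      (λ eq → 0≢1+n (sym (trans eq hub)))
      (λ eq → alternating-step k (sym (sucF-injective (trans eq (rim k j e′)))))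

  sudokuNumber : IsSudokuNumber W 2
  sudokuNumber = record
    { connected   = wheel-connected 3≤n
    ; k           = 3
    ; isChromatic = chromatic
    ; 2≤k         = s≤s (s≤s z≤n)
    ; isLeast     =
        (S , cong suc (∣⁅x⁆∣≡1 {suc m * 2} zero) , _ ,
         sudoku-restriction {G = W} coloring-proper coloring-unique) ,
        λ s has → ≤-pred (chromatic≤1+sudoku {G = W} chromatic has)
    }

-- Odd wheels: the colour pattern and the even positions

-- Even positions carry 2, 0, 1, 0, 1, …, a proper colouring of the cycle they
-- form on an odd wheel; the colours at odd positions are then forced.
oddColoring : ℕ → Fin 3
oddColoring zero          = suc (suc zero)
oddColoring (suc zero)    = suc zero
oddColoring (suc (suc i)) = period4 i
  where
  period4 : ℕ → Fin 3
  period4 zero                      = zero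
  period4 (suc zero)                = suc (suc zero)
  period4 (suc (suc zero))          = suc zero
  period4 (suc (suc (suc zero)))    = suc (suc zero)
  period4 (suc (suc (suc (suc i)))) = period4 i

-- From position 2 on the pattern has period 4, so the positions up to 5 suffice.
oddColoring-step : ∀ i → oddColoring i ≢ oddColoring (suc i)
oddColoring-step 0 ()
oddColoring-step 1 ()
oddColoring-step 2 ()
oddColoring-step 3 ()
oddColoring-step 4 ()
oddColoring-step 5 ()
oddColoring-step (suc (suc (suc (suc (suc (suc i)))))) = oddColoring-step (suc (suc i))

-- The two rim neighbours of an odd position get distinct colours, which is what forces the colour
-- in between.
oddColoring-step₂ : ∀ j → oddColoring (j * 2) ≢ oddColoring (suc j * 2)
oddColoring-step₂ 0 ()
oddColoring-step₂ 1 ()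
oddColoring-step₂ 2 ()
oddColoring-step₂ (suc (suc (suc j))) = oddColoring-step₂ (suc j)

-- The colour 2 of position 0 recurs only at odd positions, whereas the last position `m * 2` is
-- even and positive.
oddColoring-wrap : ∀ m → 3 ≤ suc (m * 2) → oddColoring (m * 2) ≢ oddColoring 0
oddColoring-wrap 0 (s≤s ())
oddColoring-wrap 1 _ ()
oddColoring-wrap 2 _ ()
oddColoring-wrap (suc (suc (suc m))) _ = oddColoring-wrap (suc m) (s≤s (s≤s (s≤s z≤n)))

evens : ∀ n → Subset n
evens zero          = []
evens (suc zero)    = inside ∷ []
evens (suc (suc n)) = inside ∷ outside ∷ evens n

∣evens∣ : ∀ m → ∣ evens (suc (m * 2)) ∣ ≡ suc m
∣evens∣ zero    = refl
∣evens∣ (suc m) = cong suc (∣evens∣ m)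

∈evens : ∀ {n} (i : Fin n) j → toℕ i ≡ j * 2 → i ∈ evens n
∈evens {suc zero}    zero          j       e = here
∈evens {suc (suc n)} zero          j       e = here
∈evens {suc (suc n)} (suc (suc i)) (suc j) e =
  there (there (∈evens i j (suc-injective (suc-injective e))))
∈evens {suc (suc n)} (suc zero)    (suc j) ()

parity-split : ∀ n → ∃ λ m → n ≡ m * 2 ⊎ n ≡ suc (m * 2)
parity-split zero    = 0 , inj₁ refl
parity-split (suc n) with parity-split n
... | m , inj₁ e = m , inj₂ (cong suc e)
... | m , inj₂ e = suc m , inj₁ (cong suc e)

-- Vertex covers of paths and cycles

bit : Bool → ℕ
bit true  = 1
bit false = 0

-- Count incidences: each of the `k` edges meets `T`, and a vertex of `T` meets at most two edges.
-- An end vertex lies one edge short of two, so its membership in `T` adds one to the left side.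
path-cover-size : ∀ {k} (T : Subset (suc k)) → (∀ (i : Fin k) → inject₁ i ∈ T ⊎ suc i ∈ T) →
                  bit (lookup T zero) + (k + bit (lookup T (fromℕ k))) ≤ ∣ T ∣ * 2
path-cover-size (true  ∷ []) cover = ≤-refl
path-cover-size (false ∷ []) cover = ≤-refl
path-cover-size (true ∷ c ∷ T) cover =
  s≤s (s≤s (≤-trans (m≤n+m _ (bit c))
    (path-cover-size (c ∷ T) (λ i → ⊎-map drop-there drop-there (cover (suc i))))))
path-cover-size (false ∷ true ∷ T) cover =
  path-cover-size (true ∷ T) (λ i → ⊎-map drop-there drop-there (cover (suc i)))
path-cover-size (false ∷ false ∷ T) cover with cover zero
... | inj₁ ()
... | inj₂ (there ())

cycle-cover-size : ∀ {n} (T : Subset n) → (∀ {i j} → Next i j → i ∈ T ⊎ j ∈ T) → n ≤ ∣ T ∣ * 2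
cycle-cover-size {zero}  T cover = z≤n
cycle-cover-size {suc k} T cover = ≤-trans ends
  (path-cover-size T (λ i → cover (inj₁ (cong suc (sym (toℕ-inject₁ i))))))
  where
  -- The closing edge has an end in `T`, so at least one of the two end terms of the path bound is
  -- 1.
  ends : suc k ≤ bit (lookup T zero) + (k + bit (lookup T (fromℕ k)))
  ends with cover {fromℕ k} {zero} (inj₂ (cong suc (toℕ-fromℕ k) , refl))
  ... | inj₁ last∈T rewrite []=⇒lookup last∈T =
    ≤-trans (≤-reflexive (+-comm 1 k)) (m≤n+m _ (bit (lookup T zero)))
  ... | inj₂ head∈T rewrite []=⇒lookup head∈T = s≤s (m≤m+n k _)

-- The cyclic successor as a bijection

Next-functional : ∀ {n} {i j j′ : Fin n} → Next i j → Next i j′ → j ≡ j′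
Next-functional (inj₁ e)       (inj₁ e′)       = toℕ-injective (trans e (sym e′))
Next-functional {j = j} (inj₁ e) (inj₂ (w , _))   = contradiction (trans e w) (<⇒≢ (toℕ<n j))
Next-functional {j′ = j′} (inj₂ (w , _)) (inj₁ e) = contradiction (trans e w) (<⇒≢ (toℕ<n j′))
Next-functional (inj₂ (_ , z)) (inj₂ (_ , z′)) = toℕ-injective (trans z (sym z′))

Next-injective : ∀ {n} {i i′ j : Fin n} → Next i j → Next i′ j → i ≡ i′
Next-injective (inj₁ e)       (inj₁ e′)       = toℕ-injective (suc-injective (trans (sym e) e′))
Next-injective (inj₁ e)       (inj₂ (_ , z))  = contradiction (trans (sym e) z) 1+n≢0
Next-injective (inj₂ (_ , z)) (inj₁ e)        = contradiction (trans (sym e) z) 1+n≢0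
Next-injective (inj₂ (w , _)) (inj₂ (w′ , _)) = toℕ-injective (suc-injective (trans w (sym w′)))

Next-total : ∀ {n} (i : Fin n) → ∃ λ j → Next i j
Next-total {suc n} i with suc (toℕ i) <? suc n
... | yes lt = fromℕ< lt , inj₁ (toℕ-fromℕ< lt)
... | no ≮   = zero , inj₂ (≤-antisym (toℕ<n i) (≮⇒≥ ≮) , refl)

Next-surjective : ∀ {n} (j : Fin n) → ∃ λ i → Next i j
Next-surjective {suc n} zero    = fromℕ n , inj₂ (cong suc (toℕ-fromℕ n) , refl)
Next-surjective {suc n} (suc j) = inject₁ j , inj₁ (cong suc (sym (toℕ-inject₁ j)))

-- Recolouring two vertices

module _ {m k : ℕ} (G : SimpleGraph (Fin m)) (c : Fin m → Fin k) {x y : Fin m} (a b : Fin k) where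

  -- One operation serves both moves: recolouring a single vertex, when the other keeps its colour,
  -- and swapping two adjacent colours.
  recolor₂ : Fin m → Fin k
  recolor₂ v with v ≟ x | v ≟ y
  ... | yes _ | _     = a
  ... | no _  | yes _ = b
  ... | no _  | no _  = c v

  recolor₂-other : ∀ {v} → v ≢ x → v ≢ y → recolor₂ v ≡ c v
  recolor₂-other {v} v≢x v≢y with v ≟ x | v ≟ y
  ... | yes e | _     = contradiction e v≢x
  ... | no _  | yes e = contradiction e v≢y
  ... | no _  | no _  = refl

  recolor₂-x : recolor₂ x ≡ a
  recolor₂-x with x ≟ x | x ≟ y
  ... | yes _ | _ = refl
  ... | no ne | _ = contradiction refl ne

  recolor₂-y : y ≢ x → recolor₂ y ≡ b
  recolor₂-y y≢x with y ≟ x | y ≟ y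
  ... | yes e | _     = contradiction e y≢x
  ... | no _  | yes _ = refl
  ... | no _  | no ne = contradiction refl ne

  -- The edge between `x` and `y`, if present, is settled by `a≢b`; only the other neighbours of `x`
  -- and `y` need checking against the new colours.
  recolor₂-proper : Proper G c → a ≢ b →
                    (∀ v → Adj G x v → v ≢ y → c v ≢ a) →
                    (∀ v → Adj G y v → v ≢ x → c v ≢ b) →
                    Proper G recolor₂
  recolor₂-proper proper a≢b x-ok y-ok p q pq
    with p ≟ x | p ≟ y | q ≟ x | q ≟ y
  ... | yes refl | _        | yes refl | _        = contradiction pq (irrefl G refl)
  ... | yes refl | _        | no _     | yes refl = a≢b
  ... | yes refl | _        | no _     | no q≢y   = x-ok q pq q≢y ∘ sym
  ... | no _     | yes refl | yes refl | _        = a≢b ∘ sym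
  ... | no _     | yes refl | no _     | yes refl = contradiction pq (irrefl G refl)
  ... | no _     | yes refl | no q≢x   | no _     = y-ok q pq q≢x ∘ sym
  ... | no _     | no p≢y   | yes refl | _        = x-ok p (symm G pq) p≢y
  ... | no p≢x   | no _     | no _     | yes refl = y-ok p (symm G pq) p≢x
  ... | no _     | no _     | no _     | no _     = proper p q pq

-- Lower bound for wheels with four colours

module _ {n : ℕ} (3≤n : 3 ≤ n) where

  -- Under these hypotheses the recolouring by `a` and `b` is proper and leaves `S` untouched, so
  -- uniqueness makes it equal to `c`.
  rim-edge-rigid : {S : Subset (suc n)} {c : Fin (suc n) → Fin 4} →
                   Proper (wheel n 3≤n) c → UniqueOn (wheel n 3≤n) S c →
                   {w i j z : Fin n} → Next w i → Next i j → Next j z →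
                   ¬ (suc i ∈ S) → ¬ (suc j ∈ S) →
                   ∀ a b → a ≢ b → c zero ≢ a → c zero ≢ b → c (suc w) ≢ a → c (suc z) ≢ b →
                   c (suc i) ≡ a × c (suc j) ≡ b
  rim-edge-rigid {S} {c} proper unique {w} {i} {j} {z} wi ij jz i∉S j∉S a b a≢b h≢a h≢b cw≢a cz≢b =
    trans (same (suc i)) (recolor₂-x G c {x = suc i} {y = suc j} a b) ,
    trans (same (suc j)) (recolor₂-y G c a b (λ e → irrefl G (sym e) (inj₁ ij)))
    where
    G = wheel n 3≤n

    i-ok : ∀ v → Adj G (suc i) v → v ≢ suc j → c v ≢ a
    i-ok zero    _         _   = h≢a
    i-ok (suc v) (inj₁ iv) v≢j = contradiction (cong suc (Next-functional iv ij)) v≢j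
    i-ok (suc v) (inj₂ vi) _   = subst (λ u → c (suc u) ≢ a) (Next-injective wi vi) cw≢a

    j-ok : ∀ v → Adj G (suc j) v → v ≢ suc i → c v ≢ b
    j-ok zero    _         _   = h≢b
    j-ok (suc v) (inj₁ jv) _   = subst (λ u → c (suc u) ≢ b) (Next-functional jz jv) cz≢b
    j-ok (suc v) (inj₂ vj) v≢i = contradiction (cong suc (Next-injective vj ij)) v≢i

    same : c ≗ recolor₂ G c a b
    same = unique (recolor₂ G c a b) (recolor₂-proper G c a b proper a≢b i-ok j-ok)
      (λ v v∈S → recolor₂-other G c a b
        (λ { refl → i∉S v∈S }) (λ { refl → j∉S v∈S }))

  rim-edge-covered : {S : Subset (suc n)} {c : Fin (suc n) → Fin 4} →
                     Proper (wheel n 3≤n) c → UniqueOn (wheel n 3≤n) S c →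
                     {i j : Fin n} → Next i j → ¬ (suc i ∈ S) → ¬ (suc j ∈ S) → ⊥
  rim-edge-covered {c = c} proper unique {i} {j} ij i∉S j∉S
    with Next-surjective i | Next-total j | fourth-color (c zero) (c (suc i)) (c (suc j))
  ... | w , wi | z , jz | t , t≢h , t≢i , t≢j
    with rim-edge-rigid proper unique wi ij jz i∉S j∉S | c (suc w) ≟ t | c (suc z) ≟ t
  -- The left outer neighbour is not coloured `t`: recolour `i` alone with `t`.
  ... | rigid | no w≢t | _ = t≢i (sym (proj₁
    (rigid t (c (suc j)) t≢j (t≢h ∘ sym) (proper _ _ tt) w≢t (proper _ _ (inj₂ jz)))))
  -- Symmetrically, recolour `j` alone with `t`.
  ... | rigid | yes _ | no z≢t = t≢j (sym (proj₂
    (rigid (c (suc i)) t (t≢i ∘ sym) (proper _ _ tt) (t≢h ∘ sym) (proper _ _ (inj₁ wi)) z≢t)))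
  -- Both outer neighbours carry `t`, so the colours of `i` and `j` can be swapped.
  ... | rigid | yes w≡t | yes z≡t = proper _ _ (inj₁ ij) (proj₁
    (rigid (c (suc j)) (c (suc i)) (proper _ _ (inj₂ ij)) (proper _ _ tt) (proper _ _ tt)
      (t≢j ∘ trans (sym w≡t)) (t≢i ∘ trans (sym z≡t))))

  wheel-sudoku-size : ∀ {s} → HasSudokuSet (wheel n 3≤n) 4 s → n ≤ s * 2
  wheel-sudoku-size (h ∷ T , refl , _ , sudoku)
    with sudoku-completion {G = wheel n 3≤n} sudoku
  ... | c , proper , unique =
    -- Only the rim part `T` has to cover the cycle; the hub can only enlarge the set.
    ≤-trans (cycle-cover-size T cover) (*-monoˡ-≤ 2 (∣p∣≤∣x∷p∣ h T))
    where
    cover : ∀ {i j} → Next i j → i ∈ T ⊎ j ∈ T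
    cover {i} {j} ij with i ∈? T | j ∈? T
    ... | yes i∈T | _       = inj₁ i∈T
    ... | no _    | yes j∈T = inj₂ j∈T
    ... | no i∉T  | no j∉T  =
      ⊥-elim (rim-edge-covered proper unique ij (i∉T ∘ drop-there) (j∉T ∘ drop-there))

-- Odd wheels: chromatic number and Sudoku number

module OddWheel (m : ℕ) (3≤n : 3 ≤ suc (m * 2)) where

  n : ℕ
  n = suc (m * 2)

  W : SimpleGraph (Fin (suc n))
  W = wheel n 3≤n

  coloring : Fin (suc n) → Fin 4
  coloring = wheelColoring 3≤n oddColoring

  coloring-proper : Proper W coloring
  coloring-proper = wheelColoring-proper 3≤n oddColoring oddColoring-step wrap
    where
    wrap : ∀ i → suc i ≡ n → oddColoring i ≢ oddColoring 0
    wrap i e eq = oddColoring-wrap m 3≤n (trans (cong oddColoring (sym (suc-injective e))) eq)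

  chromatic : IsChromaticNumber W 4
  chromatic = (coloring , coloring-proper) , λ _ → ¬colorable⇒< {G = W} ¬3-colorable
    where
    ¬3-colorable : ¬ Colorable W 3
    ¬3-colorable (c , proper) =
      proper (suc (fromℕ (m * 2))) (suc zero)
        (inj₁ (inj₂ (cong suc (toℕ-fromℕ (m * 2)) , refl)))
        (even-rim m (fromℕ (m * 2)) (toℕ-fromℕ (m * 2)))
      where
      -- With three colours, rim vertices two apart both avoid the hub's colour and that of the
      -- vertex between them, hence agree. So positions 0 and `m * 2` agree, although they are
      -- adjacent.
      even-rim : ∀ j (i : Fin n) → toℕ i ≡ j * 2 → c (suc i) ≡ c (suc zero)
      even-rim zero    zero e = refl
      even-rim (suc j) i    e with Fin-pred i e
      ... | i₁ , e₁ with Fin-pred i₁ e₁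
      ...   | i₀ , e₀ = trans
        (third-unique (c zero) (c (suc i₁)) _ _
          (spoke 3≤n proper i₁ ∘ sym)
          (spoke 3≤n proper i) (rim-edge 3≤n proper (trans e (cong suc (sym e₁))) ∘ sym)
          (spoke 3≤n proper i₀) (rim-edge 3≤n proper (trans e₁ (cong suc (sym e₀)))))
        (even-rim j i₀ e₀)

  -- The hub's colour is a hypothesis because it is obtained in two ways: forced by the rim when `n`
  -- is at least 5, prescribed when `n` is 3.
  completion : (c : Fin (suc n) → Fin 4) → Proper W c → c zero ≡ zero →
               (∀ i → i ∈ evens n → c (suc i) ≡ coloring (suc i)) → c ≗ coloring
  completion c proper hub even = λ { zero → hub ; (suc i) → rim i }
    where
    at : ∀ {k} (i : Fin n) j → toℕ i ≡ k → k ≡ j * 2 → c (suc i) ≡ suc (oddColoring k)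
    at i j refl e = even i (∈evens i j e)

    rim : ∀ i → c (suc i) ≡ coloring (suc i)
    rim i with parity-split (toℕ i)
    ... | j , inj₁ e = even i (∈evens i j e)
    ... | j , inj₂ e with Fin-pred i e
    ...   | p , ep = fourth-unique
        zero (suc (oddColoring (j * 2))) (suc (oddColoring (suc j * 2))) _ _
        (λ ()) (λ ()) (oddColoring-step₂ j ∘ sucF-injective)
        (λ eq → spoke 3≤n proper i (trans eq (sym hub)))
        (λ eq → rim-edge 3≤n proper (trans e (cong suc (sym ep)))
          (sym (trans eq (sym (at p j ep refl)))))
        (λ eq → rim-edge 3≤n proper (trans eq-q (cong suc (sym e)))
          (trans eq (sym (at q (suc j) eq-q refl))))
        (λ ())
        (λ eq → oddColoring-step (j * 2) (trans (sym (sucF-injective eq)) (cong oddColoring e)))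
        (λ eq → oddColoring-step (suc (j * 2)) (trans (cong oddColoring (sym e)) (sucF-injective eq)))
      where
      -- The last position `m * 2` is even, so an odd position always has a right neighbour without
      -- wrapping around.
      q<n : suc j * 2 < n
      q<n = s≤s (*-monoˡ-≤ 2 (*-cancelʳ-< 2 j m (≤-pred (subst (_< n) e (toℕ<n i)))))

      q : Fin n
      q = fromℕ< q<n

      eq-q : toℕ q ≡ suc j * 2
      eq-q = toℕ-fromℕ< q<n

  hubless-sudokuNumber : 5 ≤ n → IsSudokuNumber W (suc m)
  hubless-sudokuNumber 5≤n = record
    { connected   = wheel-connected 3≤n
    ; k           = 4
    ; isChromatic = chromatic
    ; 2≤k         = s≤s (s≤s z≤n)
    ; isLeast     =
        (outside ∷ evens n , ∣evens∣ m , _ ,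
         sudoku-restriction {G = W} coloring-proper unique) ,
        -- The bound `n ≤ s * 2` unfolds to `m * 2 < s * 2`.
        λ s has → *-cancelʳ-< 2 m s (wheel-sudoku-size 3≤n has)
    }
    where
    hub-forced : (c : Fin (suc n) → Fin 4) → Proper W c →
                 (∀ (i : Fin n) j → toℕ i ≡ j * 2 → c (suc i) ≡ coloring (suc i)) → c zero ≡ zero
    -- Positions 0, 2 and 4 already show all three rim colours; position 4 exists since `5 ≤ n`.
    hub-forced c proper even = fourth-unique
      (suc (oddColoring 0)) (suc (oddColoring 2)) (suc (oddColoring 4)) (c zero) zero
      (λ ()) (λ ()) (λ ())
      (avoids 0 (≤-trans (s≤s z≤n) 5≤n))
      (avoids 1 (≤-trans (s≤s (s≤s (s≤s z≤n))) 5≤n))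
      (avoids 2 5≤n)
      (λ ()) (λ ()) (λ ())
      where
      avoids : ∀ j → j * 2 < n → c zero ≢ suc (oddColoring (j * 2))
      avoids j lt eq = proper zero (suc (fromℕ< lt)) tt (trans eq (sym
        (trans (even (fromℕ< lt) j (toℕ-fromℕ< lt))
               (cong (suc ∘ oddColoring) (toℕ-fromℕ< lt)))))

    unique : UniqueOn W (outside ∷ evens n) coloring
    unique c proper agree = sym ∘ completion c proper
      (hub-forced c proper (λ i j e → agree (suc i) (there (∈evens i j e))))
      (λ i i∈ → agree (suc i) (there i∈))

-- The wheel over a triangle

module _ (3≤3 : 3 ≤ 3) where

  open OddWheel 1 3≤3

  -- The even positions 0 and 2 show only two colours, so the hub joins the set. Here χ - 1 = 3
  -- exceeds the cover bound 2 and is the one that is attained.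
  wheel₃-sudokuNumber : IsSudokuNumber W 3
  wheel₃-sudokuNumber = record
    { connected   = wheel-connected 3≤3
    ; k           = 4
    ; isChromatic = chromatic
    ; 2≤k         = s≤s (s≤s z≤n)
    ; isLeast     =
        (inside ∷ evens 3 , refl , _ ,
         sudoku-restriction {G = W} coloring-proper unique) ,
        λ s has → ≤-pred (chromatic≤1+sudoku {G = W} chromatic has)
    }
    where
    unique : UniqueOn W (inside ∷ evens 3) coloring
    unique c proper agree = sym ∘ completion c proper (agree zero here)
      (λ i i∈ → agree (suc i) (there i∈))

theorem3p14 : (n : ℕ) (3≤n : 3 ≤ n) →
    (2 ∣ n → IsSudokuNumber (wheel n 3≤n) 2) ×
    (n ≡ 3 → IsSudokuNumber (wheel n 3≤n) 3) ×
    (5 ≤ n → ¬ (2 ∣ n) → IsSudokuNumber (wheel n 3≤n) ((n + 1) / 2))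
theorem3p14 n 3≤n = even , (λ { refl → wheel₃-sudokuNumber 3≤n }) , odd
  where
  even : 2 ∣ n → IsSudokuNumber (wheel n 3≤n) 2
  even (divides zero    refl) = contradiction 3≤n λ ()
  even (divides (suc m) refl) = EvenWheel.sudokuNumber m 3≤n

  odd : 5 ≤ n → ¬ (2 ∣ n) → IsSudokuNumber (wheel n 3≤n) ((n + 1) / 2)
  odd 5≤n 2∤n with parity-split n
  ... | m , inj₁ e    = contradiction (divides m e) 2∤n
  ... | m , inj₂ refl = subst (IsSudokuNumber (wheel n 3≤n)) (sym half)
                          (OddWheel.hubless-sudokuNumber m 3≤n 5≤n)
    where
    half : (suc (m * 2) + 1) / 2 ≡ suc m
    -- After commuting, `1 + suc (m * 2)` is `suc m * 2` by computation.
    half = trans (cong (_/ 2) (+-comm (suc (m * 2)) 1)) (m*n/n≡m (suc m) 2)
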